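{- Fix a constant $\epsilon>0$. For the online set cover with repetitions problem with unit set costs described in the context, there is a deterministic online algorithm which, at every time, covers each element that has been presented $k$ times so far by at least $(1-\epsilon)k$ distinct chosen sets, and whose total number of chosen sets is $O(\log m\log n)\cdot\alpha$, where $\alpha$ is the size of an optimal cover (the constant depending on $\epsilon$).
   Context: Online set cover with repetitions, unit costs: a ground set $X$ of $n$ elements and a family $\mathcal S$ of $m$ subsets of $X$ are known in advance. An adversary presents elements of $X$ one at a time; each element may be presented an arbitrary number of times, not necessarily consecutively. The algorithm chooses sets irrevocably. An optimal cover is a minimum-size collection of sets covering each element presented $k$ times by at least $k$ distinct sets of the collection; $\alpha$ is its size (assumed to exist). -}

module Defs where

open import Data.Nat using (ℕ; suc; _*_; _≤_)
open import Data.Nat.Logarithm using (⌈log₂_⌉)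
open import Data.Fin using (Fin)
open import Data.Fin.Properties using (_≟_)
open import Data.Fin.Subset using (Subset; _∈_; _∩_; ∣_∣; _⊆_; inside; outside)
open import Data.Fin.Subset.Properties using (_∈?_)
open import Data.Vec using (tabulate)
open import Data.List using (List; filter; length; _∷ʳ_)
open import Data.Bool using (if_then_else_)
open import Relation.Nullary using (does)

Family : ℕ → ℕ → Set
Family n m = Fin m → Subset n

-- A request sequence: elements of the ground set, oldest first.
Requests : ℕ → Set
Requests n = List (Fin n)

multiplicity : ∀ {n} → Requests n → Fin n → ℕ
multiplicity σ x = length (filter (_≟ x) σ)

setsContaining : ∀ {n m} → Family n m → Fin n → Subset m
setsContaining S x = tabulate (λ i → if does (x ∈? S i) then inside else outside)

coverCount : ∀ {n m} → Family n m → Subset m → Fin n → ℕ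
coverCount S F x = ∣ F ∩ setsContaining S x ∣

IsCover : ∀ {n m} → Family n m → Requests n → Subset m → Set
IsCover S σ F = ∀ x → multiplicity σ x ≤ coverCount S F x

-- A deterministic online algorithm for a fixed instance (n, m, S):
-- the collection of chosen sets after the request prefix σ has been seen.
-- Being a function of the prefix makes it deterministic and online.
OnlineAlg : ℕ → ℕ → Set
OnlineAlg n m = Requests n → Subset m

Irrevocable : ∀ {n m} → OnlineAlg n m → Set
Irrevocable A = ∀ σ x → A σ ⊆ A (σ ∷ʳ x)

-- the factor log m · log n (with logarithms rounded up and shifted by one so
-- that the factor is at least 1 also when m or n is 1)
logFactor : ℕ → ℕ → ℕ
logFactor n m = suc ⌈log₂ m ⌉ * suc ⌈log₂ n ⌉

-- Every set carries a weight, initially at most 1/(2m). When x has been requested k times and is covered by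
-- c < (1 - 1/d) k bought sets, all unbought sets containing x double their weight w and are bought with
-- probability 2w. Two facts about this random process are expressed by estimators with non-increasing
-- expectation: the number of bought sets is O(log n + log G), where G = Π (1 + w) over all sets, and the
-- product of 1 + w over the unbought sets containing x is at most O(n) 2^c. The method of conditional
-- expectations makes the process deterministic while keeping the sum of the estimators O(n).
-- By the second fact a doubling multiplies G by at most 2^(c + O(log n)). On the other hand a cover has at
-- least k - c > k/d unbought sets containing x, and each of its sets doubles only O(log m) times, so that
-- log G = O(d log m log n) times the size of the cover.
module Submission where

open import Defs
open import Data.Nat using (ℕ; _*_; _≤_)
open import Data.Integer using (+_)
open import Data.Rational using (ℚ; 0ℚ; 1ℚ; _-_; _/_) renaming (_*_ to _*ℚ_; _≤_ to _≤ℚ_; _<_ to _<ℚ_)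
open import Data.Fin.Subset using (Subset; ∣_∣)
open import Data.Product using (Σ; ∃; _×_)

open import Data.Bool using (Bool; true; false; _∧_; if_then_else_)
open import Data.Bool.Properties using (∧-comm)
open import Data.Fin using (Fin; zero; suc)
open import Data.Fin.Properties using (_≟_)
open import Data.Fin.Subset using (_∩_)
open import Data.Fin.Subset.Properties using (_∈?_; ∣p∣≤n; ∣p∩q∣≤∣p∣)
import Data.Integer as ℤ
import Data.Integer.Properties as ℤ
open import Data.Integer.Tactic.RingSolver using () renaming (solve-∀ to ℤ-solve-∀)
open import Data.List using ([]; _∷_; _∷ʳ_; reverse)
open import Data.List.Properties using (reverse-++)
open import Data.List.Relation.Binary.Permutation.Propositional.Properties
  using (↭-length; ↭-reverse; filter-↭)
open import Data.Nat using (zero; suc; _+_; _∸_; _^_; _<_; z≤n; s≤s; _≤?_; _<?_; NonZero; >-nonZero; ⌊_/2⌋; ⌈_/2⌉)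
open import Data.Nat.Induction using (Acc; acc; <-wellFounded)
open import Data.Nat.Logarithm using (⌈log₂_⌉)
open import Data.Nat.Logarithm.Core using (⌈log2⌉)
open import Data.Nat.Properties hiding (_≟_)
open import Data.Nat.Tactic.RingSolver using (solve-∀)
open import Data.Product using (_,_; proj₁; proj₂)
open import Data.Rational using (mkℚ; -_; ↧ₙ_; toℚᵘ; *<*)
import Data.Rational.Properties as ℚ
open import Data.Rational.Unnormalised using (mkℚᵘ; 1ℚᵘ; *≤*) renaming (_*_ to _*ᵘ_; _+_ to _+ᵘ_; -_ to -ᵘ_)
import Data.Rational.Unnormalised.Properties as ℚᵘ
open import Data.Sum using (_⊎_; inj₁; inj₂)
open import Data.Vec using (lookup; tabulate; []; _∷_)
open import Data.Vec.Properties using (lookup-zipWith; lookup∘tabulate; lookup⇒[]=; []=⇒lookup)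
open import Function using (_∘_)
open import Relation.Binary.PropositionalEquality
open import Relation.Nullary using (¬_; Dec; yes; no; does; contradiction)
open import Algebra.Properties.Semiring.Sum +-*-semiring
  using (sum; sum-cong-≗; sum-replicate-zero; ∑-distrib-+; *-distribˡ-sum)
open import Algebra.Properties.CommutativeMonoid.Sum *-1-commutativeMonoid
  using () renaming (sum to product; ∑-distrib-+ to product-distrib-*)

-- Sums, products, powers and logarithms of natural numbers.

sum-mono-≤ : ∀ {n} {f g : Fin n → ℕ} → (∀ i → f i ≤ g i) → sum f ≤ sum g
sum-mono-≤ {zero}  f≤g = z≤n
sum-mono-≤ {suc n} f≤g = +-mono-≤ (f≤g zero) (sum-mono-≤ (f≤g ∘ suc))

sum-≤-const : ∀ {n b} {f : Fin n → ℕ} → (∀ i → f i ≤ b) → sum f ≤ n * b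
sum-≤-const {zero}  f≤b = z≤n
sum-≤-const {suc n} f≤b = +-mono-≤ (f≤b zero) (sum-≤-const (f≤b ∘ suc))

≤-sum : ∀ {n} (f : Fin n → ℕ) i → f i ≤ sum f
≤-sum f zero    = m≤m+n _ _
≤-sum f (suc i) = ≤-trans (≤-sum (f ∘ suc) i) (m≤n+m _ _)

product-mono-≤ : ∀ {n} {f g : Fin n → ℕ} → (∀ i → f i ≤ g i) → product f ≤ product g
product-mono-≤ {zero}  f≤g = ≤-refl
product-mono-≤ {suc n} f≤g = *-mono-≤ (f≤g zero) (product-mono-≤ (f≤g ∘ suc))

product-const : ∀ n b → product {n} (λ _ → b) ≡ b ^ n
product-const zero    b = refl
product-const (suc n) b = cong (b *_) (product-const n b)

product-^ : ∀ {n} b (f : Fin n → ℕ) → product (λ i → b ^ f i) ≡ b ^ sum f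
product-^ {zero}  b f = refl
product-^ {suc n} b f =
  trans (cong (b ^ f zero *_) (product-^ b (f ∘ suc))) (sym (^-distribˡ-+-* b (f zero) (sum (f ∘ suc))))

^-distribʳ-* : ∀ a b n → (a * b) ^ n ≡ a ^ n * b ^ n
^-distribʳ-* a b zero    = refl
^-distribʳ-* a b (suc n) = trans (cong (a * b *_) (^-distribʳ-* a b n)) (interchange a b (a ^ n) (b ^ n))
  where
  interchange : ∀ a b c d → a * b * (c * d) ≡ a * c * (b * d)
  interchange = solve-∀

n≤2^⌈log₂n⌉ : ∀ n → n ≤ 2 ^ ⌈log₂ n ⌉
n≤2^⌈log₂n⌉ n = go n (<-wellFounded n)
  where
  double : ∀ k → suc (suc (k + k)) ≡ 2 * suc k
  double = solve-∀
  -- `⌈log2⌉` recurses on an accessibility proof, so the induction follows its clauses for an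
  -- arbitrary such proof.
  go : ∀ n (rec : Acc _<_ n) → n ≤ 2 ^ ⌈log2⌉ n rec
  go 0             _        = z≤n
  go 1             _        = ≤-refl
  go (suc (suc n)) (acc rs) = begin
    suc (suc n)                       ≡⟨ cong (λ k → 2 + k) (⌊n/2⌋+⌈n/2⌉≡n n) ⟨
    suc (suc (⌊ n /2⌋ + ⌈ n /2⌉))     ≤⟨ s≤s (s≤s (+-monoˡ-≤ ⌈ n /2⌉ (⌊n/2⌋≤⌈n/2⌉ n))) ⟩
    suc (suc (⌈ n /2⌉ + ⌈ n /2⌉))     ≡⟨ double ⌈ n /2⌉ ⟩
    2 * suc ⌈ n /2⌉                   ≤⟨ *-monoʳ-≤ 2 (go (suc ⌈ n /2⌉) (rs (⌈n/2⌉<n n))) ⟩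
    2 * 2 ^ ⌈log2⌉ (suc ⌈ n /2⌉) _    ∎
    where open ≤-Reasoning

-- (1 + 1/M)^t ≤ 1 + 2t/M, cleared of denominators.
[1+M]^t-bound : ∀ M t → 2 * t ≤ M → suc M ^ t * M ≤ M ^ t * (M + 2 * t)
[1+M]^t-bound M zero    _     = ≤-reflexive (base M)
  where
  base : ∀ M → 1 * M ≡ 1 * (M + 2 * 0)
  base = solve-∀
[1+M]^t-bound M (suc t) 2t+2≤M = begin
  suc M * suc M ^ t * M                        ≡⟨ *-assoc (suc M) (suc M ^ t) M ⟩
  suc M * (suc M ^ t * M)                      ≤⟨ *-monoʳ-≤ (suc M) ([1+M]^t-bound M t 2t≤M) ⟩
  suc M * (M ^ t * (M + 2 * t))                ≡⟨ expand M t (M ^ t) ⟩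
  M ^ t * (M * M + M * (2 * t) + M + 2 * t)    ≤⟨ *-monoʳ-≤ (M ^ t) (+-monoʳ-≤ (M * M + M * (2 * t) + M) 2t≤M) ⟩
  M ^ t * (M * M + M * (2 * t) + M + M)        ≡⟨ collect M t (M ^ t) ⟩
  M * M ^ t * (M + 2 * suc t)                  ∎
  where
  open ≤-Reasoning
  2t≤M : 2 * t ≤ M
  2t≤M = ≤-trans (*-monoʳ-≤ 2 (n≤1+n t)) 2t+2≤M
  expand : ∀ M t p → suc M * (p * (M + 2 * t)) ≡ p * (M * M + M * (2 * t) + M + 2 * t)
  expand = solve-∀
  collect : ∀ M t p → p * (M * M + M * (2 * t) + M + M) ≡ M * p * (M + 2 * suc t)
  collect = solve-∀

[1+M]^t≤2*M^t : ∀ M t .{{_ : NonZero M}} → 2 * t ≤ M → suc M ^ t ≤ 2 * M ^ t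
[1+M]^t≤2*M^t M t 2t≤M = *-cancelʳ-≤ _ _ M (begin
  suc M ^ t * M            ≤⟨ [1+M]^t-bound M t 2t≤M ⟩
  M ^ t * (M + 2 * t)      ≤⟨ *-monoʳ-≤ (M ^ t) (+-monoʳ-≤ M 2t≤M) ⟩
  M ^ t * (M + M)          ≡⟨ collect M (M ^ t) ⟩
  2 * M ^ t * M            ∎)
  where
  open ≤-Reasoning
  collect : ∀ M p → p * (M + M) ≡ 2 * p * M
  collect = solve-∀

-- The constant 4 works because (5/4)^4 > 2.
5^c≤4^c*2^b⇒c≤4*b : ∀ b c → 5 ^ c ≤ 4 ^ c * 2 ^ b → c ≤ 4 * b
5^c≤4^c*2^b⇒c≤4*b b c 5^c≤ with c ≤? 4 * b
... | yes c≤4b = c≤4b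
... | no  c≰4b = contradiction 5^c≤ (<⇒≱ (begin-strict
  4 ^ c * 2 ^ b                            ≡⟨ cong (λ k → 4 ^ k * 2 ^ b) c≡ ⟩
  4 ^ (4 * b + r) * 2 ^ b                  ≡⟨ cong (_* 2 ^ b) (^-distribˡ-+-* 4 (4 * b) r) ⟩
  4 ^ (4 * b) * 4 ^ r * 2 ^ b              ≡⟨ cong (λ k → k * 4 ^ r * 2 ^ b) (^-*-assoc 4 4 b) ⟨
  256 ^ b * 4 ^ r * 2 ^ b                  ≡⟨ swap (256 ^ b) (4 ^ r) (2 ^ b) ⟩
  256 ^ b * 2 ^ b * 4 ^ r                  ≡⟨ cong (_* 4 ^ r) (^-distribʳ-* 256 2 b) ⟨
  512 ^ b * 4 ^ r                          ≤⟨ *-monoˡ-≤ (4 ^ r) (^-monoˡ-≤ b (m≤m+n 512 113)) ⟩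
  625 ^ b * 4 ^ r                          <⟨ *-monoʳ-< (625 ^ b) {{m^n≢0 625 b}} (^-monoˡ-< r {{>-nonZero (m<n⇒0<n∸m 4b<c)}} (n<1+n 4)) ⟩
  625 ^ b * 5 ^ r                          ≡⟨ cong (_* 5 ^ r) (^-*-assoc 5 4 b) ⟩
  5 ^ (4 * b) * 5 ^ r                      ≡⟨ ^-distribˡ-+-* 5 (4 * b) r ⟨
  5 ^ (4 * b + r)                          ≡⟨ cong (5 ^_) c≡ ⟨
  5 ^ c                                    ∎))
  where
  open ≤-Reasoning
  4b<c = ≰⇒> c≰4b
  r = c ∸ 4 * b
  c≡ : c ≡ 4 * b + r
  c≡ = sym (m+[n∸m]≡n (<⇒≤ 4b<c))
  swap : ∀ x y z → x * y * z ≡ x * z * y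
  swap = solve-∀

-- Counting in subsets.

indicator : Bool → ℕ
indicator b = if b then 1 else 0

∣p∣≡sum : ∀ {n} (p : Subset n) → ∣ p ∣ ≡ sum (indicator ∘ lookup p)
∣p∣≡sum []          = refl
∣p∣≡sum (true  ∷ p) = cong suc (∣p∣≡sum p)
∣p∣≡sum (false ∷ p) = ∣p∣≡sum p

contains : ∀ {n m} → Family n m → Fin n → Fin m → Bool
contains S x i = does (x ∈? S i)

coverCount≡sum : ∀ {n m} (S : Family n m) F x →
  coverCount S F x ≡ sum (λ i → indicator (lookup F i ∧ contains S x i))
coverCount≡sum S F x = trans (∣p∣≡sum (F ∩ setsContaining S x)) (sum-cong-≗ λ i → cong indicator
  (trans (lookup-zipWith _∧_ i F (setsContaining S x))
  (cong (lookup F i ∧_) (trans (lookup∘tabulate _ i) (if-η (contains S x i))))))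
  where
  if-η : ∀ b → (if b then true else false) ≡ b
  if-η true  = refl
  if-η false = refl

multiplicity-reverse : ∀ {n} (σ : Requests n) x → multiplicity (reverse σ) x ≡ multiplicity σ x
multiplicity-reverse σ x = ↭-length (filter-↭ (_≟ x) (↭-reverse σ))

-- Averaging and conditional expectations.

-- The method of conditional expectations: fixing one coordinate moves its factor into the coefficients c.
derandomise : ∀ {A : Set} {N m}
  (φ : Fin N → Fin m → A → ℕ) (Step : Fin m → A → A → Set) →
  (∀ i a (c : Fin N → ℕ) → ∃ λ a′ →
    Step i a a′ × sum (λ j → c j * φ j i a′) ≤ sum (λ j → c j * φ j i a)) →
  (c : Fin N → ℕ) (s : Fin m → A) → ∃ λ (s′ : Fin m → A) → (∀ i → Step i (s i) (s′ i)) ×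
    sum (λ j → c j * product (λ i → φ j i (s′ i))) ≤ sum (λ j → c j * product (λ i → φ j i (s i)))
derandomise {m = zero}  φ Step choose c s = s , (λ ()) , ≤-refl
derandomise {m = suc m} φ Step choose c s
  with a , step , a-bound ← choose zero (s zero) (λ j → c j * product (λ i → φ j (suc i) (s (suc i))))
  with s′ , steps , s′-bound ← derandomise (λ j → φ j ∘ suc) (Step ∘ suc) (choose ∘ suc)
                                 (λ j → c j * φ j zero a) (s ∘ suc)
  = (λ { zero → a ; (suc i) → s′ i })
  , (λ { zero → step ; (suc i) → steps i })
  , (begin
      sum (λ j → c j * (φ j zero a * product (λ i → φ j (suc i) (s′ i))))
        ≡⟨ sum-cong-≗ (λ j → *-assoc (c j) (φ j zero a) _) ⟨
      sum (λ j → c j * φ j zero a * product (λ i → φ j (suc i) (s′ i)))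
        ≤⟨ s′-bound ⟩
      sum (λ j → c j * φ j zero a * product (λ i → φ j (suc i) (s (suc i))))
        ≡⟨ sum-cong-≗ (λ j → swap (c j) (φ j zero a) _) ⟩
      sum (λ j → c j * product (λ i → φ j (suc i) (s (suc i))) * φ j zero a)
        ≤⟨ a-bound ⟩
      sum (λ j → c j * product (λ i → φ j (suc i) (s (suc i))) * φ j zero (s zero))
        ≡⟨ sum-cong-≗ (λ j → sym (unswap (c j) (φ j zero (s zero)) _)) ⟩
      sum (λ j → c j * (φ j zero (s zero) * product (λ i → φ j (suc i) (s (suc i))))) ∎)
  where
  open ≤-Reasoning
  swap : ∀ x y z → x * y * z ≡ x * z * y
  swap = solve-∀
  unswap : ∀ x y z → x * (y * z) ≡ x * z * y
  unswap = solve-∀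

-- Linearity of expectation: an averaging inequality valid for each estimator survives coefficients
-- `c`. The outcomes `a` and `b` have probabilities in the ratio `p` to `q`.
sum-average : ∀ {N} p q (c a b s : Fin N → ℕ) →
  (∀ j → p * a j + q * b j ≤ (p + q) * s j) →
  p * sum (λ j → c j * a j) + q * sum (λ j → c j * b j) ≤ (p + q) * sum (λ j → c j * s j)
sum-average p q c a b s avg = begin
  p * sum (λ j → c j * a j) + q * sum (λ j → c j * b j)
    ≡⟨ cong₂ _+_ (*-distribˡ-sum p (λ j → c j * a j)) (*-distribˡ-sum q (λ j → c j * b j)) ⟩
  sum (λ j → p * (c j * a j)) + sum (λ j → q * (c j * b j))
    ≡⟨ ∑-distrib-+ (λ j → p * (c j * a j)) (λ j → q * (c j * b j)) ⟨
  sum (λ j → p * (c j * a j) + q * (c j * b j))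
    ≤⟨ sum-mono-≤ (λ j → begin
         p * (c j * a j) + q * (c j * b j)  ≡⟨ factor p q (c j) (a j) (b j) ⟩
         c j * (p * a j + q * b j)          ≤⟨ *-monoʳ-≤ (c j) (avg j) ⟩
         c j * ((p + q) * s j)              ≡⟨ commute (c j) (p + q) (s j) ⟩
         (p + q) * (c j * s j)              ∎) ⟩
  sum (λ j → (p + q) * (c j * s j))
    ≡⟨ *-distribˡ-sum (p + q) (λ j → c j * s j) ⟨
  (p + q) * sum (λ j → c j * s j) ∎
  where
  open ≤-Reasoning
  factor : ∀ p q c a b → p * (c * a) + q * (c * b) ≡ c * (p * a + q * b)
  factor = solve-∀
  commute : ∀ x y z → x * (y * z) ≡ y * (x * z)
  commute = solve-∀

-- Coverage as a rational inequality.

-- The numerator of `ε` is at least 1, so `ε` is at least 1/q for its denominator q, and coverage (1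
-- - 1/q) k suffices. The hypothesis is that bound with denominators cleared and no subtraction.
fractional-coverage : ∀ ε → 0ℚ <ℚ ε → ∀ k c → ↧ₙ ε * k ≤ ↧ₙ ε * c + k →
  ((1ℚ - ε) *ℚ ((ℤ.+ k) / 1)) ≤ℚ ((ℤ.+ c) / 1)
fractional-coverage (mkℚ (ℤ.+ zero) _ _) (*<* (ℤ.+<+ ()))
fractional-coverage (mkℚ ℤ.-[1+ _ ] _ _) (*<* ())
fractional-coverage ε@(mkℚ (ℤ.+ suc p) q-1 _) _ k c qk≤qc+k = ℚ.toℚᵘ-cancel-≤ (begin
  toℚᵘ ((1ℚ - ε) *ℚ (ℤ.+ k / 1))                     ≃⟨ ℚ.toℚᵘ-homo-* (1ℚ - ε) (ℤ.+ k / 1) ⟩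
  toℚᵘ (1ℚ - ε) *ᵘ toℚᵘ (ℤ.+ k / 1)                  ≃⟨ ℚᵘ.*-cong 1-ε≃ (ℚ.toℚᵘ-fromℚᵘ (mkℚᵘ (ℤ.+ k) 0)) ⟩
  (1ℚᵘ +ᵘ -ᵘ (toℚᵘ ε)) *ᵘ mkℚᵘ (ℤ.+ k) 0             ≤⟨ *≤* numerators ⟩
  mkℚᵘ (ℤ.+ c) 0                                     ≃⟨ ℚ.toℚᵘ-fromℚᵘ (mkℚᵘ (ℤ.+ c) 0) ⟨
  toℚᵘ (ℤ.+ c / 1)                                   ∎)
  where
  open ℚᵘ.≤-Reasoning
  q = suc q-1
  1-ε≃ = ℚᵘ.≃-trans (ℚ.toℚᵘ-homo-+ 1ℚ (- ε)) (ℚᵘ.+-congʳ 1ℚᵘ (ℚ.toℚᵘ-homo‿- ε))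
  expand : ∀ p q k → ((ℤ.1ℤ ℤ.* q ℤ.+ (ℤ.- p) ℤ.* ℤ.1ℤ) ℤ.* k) ℤ.* ℤ.1ℤ ≡ q ℤ.* k ℤ.- p ℤ.* k
  expand = ℤ-solve-∀
  cancel : ∀ x y → x ℤ.+ y ℤ.- y ≡ x
  cancel = ℤ-solve-∀
  commute : ∀ q c → q ℤ.* c ≡ c ℤ.* (ℤ.1ℤ ℤ.* q ℤ.* ℤ.1ℤ)
  commute = ℤ-solve-∀
  qk≤qc+pk : q * k ≤ q * c + suc p * k
  qk≤qc+pk = ≤-trans qk≤qc+k (+-monoʳ-≤ (q * c) (m≤m+n k (p * k)))
  numerators : ((ℤ.1ℤ ℤ.* ℤ.+ q ℤ.+ (ℤ.- ℤ.+ suc p) ℤ.* ℤ.1ℤ) ℤ.* ℤ.+ k) ℤ.* ℤ.1ℤ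
    ℤ.≤ ℤ.+ c ℤ.* (ℤ.1ℤ ℤ.* ℤ.+ q ℤ.* ℤ.1ℤ)
  numerators = subst₂ ℤ._≤_
    (trans (cong₂ ℤ._-_ (ℤ.pos-* q k) (ℤ.pos-* (suc p) k)) (sym (expand (ℤ.+ suc p) (ℤ.+ q) (ℤ.+ k))))
    (trans (cancel (ℤ.+ (q * c)) (ℤ.+ (suc p * k))) (trans (ℤ.pos-* q c) (commute (ℤ.+ q) (ℤ.+ c))))
    (ℤ.+-monoˡ-≤ (ℤ.- ℤ.+ (suc p * k)) (ℤ.+≤+ qk≤qc+pk))

-- Levels of sets and the averaging inequalities.

-- Level `e` encodes the weight 2^e / 2^L. A waiting set stays below `L`, so twice its weight is a
-- probability; only a chosen set can reach weight 1.
data Status (L : ℕ) : Set where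
  waiting : ∀ e → e < L → Status L
  chosen  : ∀ e → e ≤ L → Status L

level : ∀ {L} → Status L → ℕ
level (waiting e _) = e
level (chosen  e _) = e

level≤ : ∀ {L} (a : Status L) → level a ≤ L
level≤ (waiting e e<L) = <⇒≤ e<L
level≤ (chosen  e e≤L) = e≤L

isChosen : ∀ {L} → Status L → Bool
isChosen (waiting _ _) = false
isChosen (chosen  _ _) = true

data Augment {L} : Bool → Status L → Status L → Set where
  outside : ∀ {a} → Augment false a a
  settled : ∀ {e p} → Augment true (chosen e p) (chosen e p)
  raised  : ∀ {e p q} → Augment true (waiting e p) (waiting (suc e) q)
  bought  : ∀ {e p q} → Augment true (waiting e p) (chosen (suc e) q)

-- A set containing the element either gains a level or was already chosen. `f` marks membership in
-- a comparison cover; the last term drops it, so that its sum counts all chosen sets containing the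
-- element.
augment-level : ∀ {L t} {a a′ : Status L} → Augment t a a′ → ∀ f →
  indicator f * level a + indicator (f ∧ t) ≤ indicator f * level a′ + indicator (t ∧ isChosen a)
augment-level (outside {a}) false = ≤-refl
augment-level (outside {a}) true  = ≤-refl
augment-level settled      false = z≤n
augment-level settled      true  = ≤-refl
augment-level raised       false = ≤-refl
augment-level (raised {e}) true  = ≤-reflexive (shift e)
  where
  shift : ∀ e → 1 * e + 1 ≡ 1 * suc e + 0
  shift = solve-∀
augment-level bought       false = ≤-refl
augment-level (bought {e}) true  = ≤-reflexive (shift e)
  where
  shift : ∀ e → 1 * e + 1 ≡ 1 * suc e + 0
  shift = solve-∀

augment-chosen : ∀ {L t} {a a′ : Status L} → Augment t a a′ → isChosen a ≡ true → isChosen a′ ≡ true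
augment-chosen outside eq = eq
augment-chosen settled eq = refl

-- In the averaging lemmas x stands for the weight x / M. The set is bought with probability 2x / M,
-- hence with the relative frequencies z and 2x for the two outcomes, where z + 2x = M.

-- With w = x / M, (1 - 2w) 4 (2 - 2w) + 2w 5 (2 - 2w) = 4 (2 - w) - 4 w^2: the decrease of 2 - w
-- pays for the factor 5/4 of a purchase.
overspend-average : ∀ {M} x z → z + 2 * x ≡ M →
  z * (4 * (2 * M ∸ 2 * x)) + 2 * x * (5 * (2 * M ∸ 2 * x)) ≤ (z + 2 * x) * (4 * (2 * M ∸ x))
overspend-average x z refl =
  subst₂ (λ u v → z * (4 * u) + 2 * x * (5 * u) ≤ (z + 2 * x) * (4 * v))
    (sym (trans (cong (_∸ 2 * x) (split z x)) (m+n∸n≡m (2 * z + 2 * x) (2 * x))))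
    (sym (trans (cong (_∸ x) (split′ z x)) (m+n∸n≡m (2 * z + 3 * x) x)))
    (m+n≤o⇒m≤o _ (≤-reflexive (slack x z)))
  where
  split : ∀ z x → 2 * (z + 2 * x) ≡ 2 * z + 2 * x + 2 * x
  split = solve-∀
  split′ : ∀ z x → 2 * (z + 2 * x) ≡ 2 * z + 3 * x + x
  split′ = solve-∀
  slack : ∀ x z → z * (4 * (2 * z + 2 * x)) + 2 * x * (5 * (2 * z + 2 * x)) + 4 * (x * x)
    ≡ (z + 2 * x) * (4 * (2 * z + 3 * x))
  slack = solve-∀

-- With w = x / M, (1 - 2w) 8 (1 + 2w) + 2w 4 = 8 (1 + w) - 32 w^2: the drop to 1/2 on a purchase
-- offsets the doubled weight.
shortfall-average : ∀ {M} x z → z + 2 * x ≡ M →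
  z * (8 * (M + 2 * x)) + 2 * x * (4 * M) ≤ (z + 2 * x) * (8 * (M + x))
shortfall-average x z refl = m+n≤o⇒m≤o _ (≤-reflexive (slack x z))
  where
  slack : ∀ x z → z * (8 * (z + 2 * x + 2 * x)) + 2 * x * (4 * (z + 2 * x)) + 32 * (x * x)
    ≡ (z + 2 * x) * (8 * (z + 2 * x + x))
  slack = solve-∀

-- (2 - w)(1 + w) ≥ 2 for 0 ≤ w ≤ 1.
overspend-bound : ∀ {M} x y → y + x ≡ M → M * (8 * M) ≤ 4 * (2 * M ∸ x) * (M + x)
overspend-bound x y refl =
  subst (λ u → (y + x) * (8 * (y + x)) ≤ 4 * u * (y + x + x))
    (sym (trans (cong (_∸ x) (split y x)) (m+n∸n≡m (2 * y + x) x)))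
    (m+n≤o⇒m≤o _ (≤-reflexive (slack x y)))
  where
  split : ∀ y x → 2 * (y + x) ≡ 2 * y + x + x
  split = solve-∀
  slack : ∀ x y → (y + x) * (8 * (y + x)) + 4 * (x * y) ≡ 4 * (2 * y + x) * (y + x + x)
  slack = solve-∀

-- The two outcomes cannot both lie above the average. Keeping the factor `p` makes the conclusion
-- absurd for p = 0, where the outcome `b` is certain.
average-excess : ∀ p q {a b s} .{{_ : NonZero q}} →
  p * a + q * b ≤ (p + q) * s → s < b → ¬ (p * s ≤ p * a)
average-excess p q {a} {b} {s} avg s<b ps≤pa = <⇒≱ (begin-strict
  (p + q) * s    ≡⟨ *-distribʳ-+ s p q ⟩
  p * s + q * s  <⟨ +-mono-≤-< ps≤pa (*-monoʳ-< q s<b) ⟩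
  p * a + q * b  ∎) avg
  where open ≤-Reasoning

-- The algorithm and its estimators.

module Algorithm {n m} (S : Family n m) (d : ℕ) where

  -- `M` is at least 2m; weights start at 1/M and reach 1 after `L` doublings. `2 ^ r` is at least 1
  -- + 2n, which bounds the initial sum of normalised estimators.
  L M r : ℕ
  L = suc ⌈log₂ m ⌉
  M = 2 ^ L
  r = 2 + ⌈log₂ n ⌉

  instance
    M≢0 : NonZero M
    M≢0 = m^n≢0 2 L

  State : Set
  State = Fin m → Status L

  -- Index zero belongs to the number of chosen sets, index suc x to the coverage of the element x.
  -- A chosen set keeps its last weight in the former estimator, which compares that number with growth.
  waitingFactor chosenFactor : Fin (suc n) → Fin m → ℕ → ℕ
  waitingFactor zero    i e = 4 * (2 * M ∸ 2 ^ e)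
  waitingFactor (suc x) i e = if contains S x i then 8 * (M + 2 ^ e) else 8 * M
  chosenFactor zero    i e = 5 * (2 * M ∸ 2 ^ e)
  chosenFactor (suc x) i e = if contains S x i then 4 * M else 8 * M

  factor : Fin (suc n) → Fin m → Status L → ℕ
  factor j i (waiting e _) = waitingFactor j i e
  factor j i (chosen  e _) = chosenFactor j i e

  -- Normalised by `(8 * M) ^ m`, index zero is (5/4)^(number of chosen sets) times the product of 1
  -- - w/2 over all sets. Index `suc x` is 2^(-c) times the product of 1 + w over the waiting sets
  -- containing x, where c chosen sets contain x.
  estimator : Fin (suc n) → State → ℕ
  estimator j s = product (λ i → factor j i (s i))

  potential : State → ℕ
  potential s = sum (λ j → 1 * estimator j s)

  factor-average : ∀ j i e → e < L →
    (M ∸ 2 ^ suc e) * waitingFactor j i (suc e) + 2 ^ suc e * chosenFactor j i (suc e)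
      ≤ (M ∸ 2 ^ suc e + 2 ^ suc e) * waitingFactor j i e
  factor-average j i e e<L = go j
    where
    M≡ : M ∸ 2 ^ suc e + 2 * 2 ^ e ≡ M
    M≡ = m∸n+n≡m (^-monoʳ-≤ 2 e<L)
    go : ∀ j → (M ∸ 2 ^ suc e) * waitingFactor j i (suc e) + 2 ^ suc e * chosenFactor j i (suc e)
      ≤ (M ∸ 2 ^ suc e + 2 ^ suc e) * waitingFactor j i e
    go zero = overspend-average (2 ^ e) (M ∸ 2 ^ suc e) M≡
    go (suc x) with contains S x i
    ... | true  = shortfall-average (2 ^ e) (M ∸ 2 ^ suc e) M≡
    ... | false = ≤-reflexive (sym (*-distribʳ-+ (8 * M) (M ∸ 2 ^ suc e) (2 ^ suc e)))

  -- Buying is tried first; if it raises the weighted sum, averaging keeps the other outcome from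
  -- doing so. The coefficients are arbitrary because they change along the derandomisation.
  choose : ∀ t i a (c : Fin (suc n) → ℕ) → ∃ λ a′ → Augment t a a′ ×
    sum (λ j → c j * factor j i a′) ≤ sum (λ j → c j * factor j i a)
  choose false i a c = a , outside , ≤-refl
  choose true i a@(chosen _ _) c = a , settled , ≤-refl
  choose true i a@(waiting e e<L) c = go (combine chosenFactor (suc e) ≤? combine waitingFactor e) (suc e <? L)
    where
    combine : (Fin (suc n) → Fin m → ℕ → ℕ) → ℕ → ℕ
    combine f e = sum (λ j → c j * f j i e)
    average = sum-average (M ∸ 2 ^ suc e) (2 ^ suc e) c (λ j → waitingFactor j i (suc e))
      (λ j → chosenFactor j i (suc e)) (λ j → waitingFactor j i e) (λ j → factor-average j i e e<L)
    excess = average-excess (M ∸ 2 ^ suc e) (2 ^ suc e) {{m^n≢0 2 (suc e)}} average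
    go : Dec (combine chosenFactor (suc e) ≤ combine waitingFactor e) → Dec (suc e < L) →
      ∃ λ a′ → Augment true a a′ × sum (λ j → c j * factor j i a′) ≤ combine waitingFactor e
    go (yes buy≤) _              = chosen (suc e) e<L , bought , buy≤
    go (no buy≰)  (yes 1+e<L)    = waiting (suc e) 1+e<L , raised ,
      ≮⇒≥ (λ lt → excess (≰⇒> buy≰) (*-monoʳ-≤ (M ∸ 2 ^ suc e) (<⇒≤ lt)))
    -- At the last level the purchase has probability 1: the other outcome has frequency 0, and
    -- `excess` becomes absurd.
    go (no buy≰)  (no 1+e≮L)     = contradiction
      (subst (λ z → z * combine waitingFactor e ≤ z * combine waitingFactor (suc e)) (sym M∸≡0) z≤n)
      (excess (≰⇒> buy≰))
      where
      M∸≡0 : M ∸ 2 ^ suc e ≡ 0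
      M∸≡0 = m≤n⇒m∸n≡0 (^-monoʳ-≤ 2 (≮⇒≥ 1+e≮L))

  abstract
    augmentation : ∀ x (s : State) → ∃ λ (s′ : State) →
      (∀ i → Augment (contains S x i) (s i) (s′ i)) × potential s′ ≤ potential s
    augmentation x s =
      derandomise factor (λ i → Augment (contains S x i)) (λ i → choose (contains S x i) i) (λ _ → 1) s

  augment : Fin n → State → State
  augment x s = proj₁ (augmentation x s)

  augment-step : ∀ x s i → Augment (contains S x i) (s i) (augment x s i)
  augment-step x s = proj₁ (proj₂ (augmentation x s))

  covered : Fin n → State → ℕ
  covered x s = sum (λ i → indicator (contains S x i ∧ isChosen (s i)))

  -- The test is d c ≥ (d - 1) k for the coverage c, written without subtraction.
  serve : ℕ → Fin n → ℕ → State → State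
  serve zero       x k s = s
  serve (suc fuel) x k s with d * k ≤? d * covered x s + k
  ... | yes _ = s
  ... | no  _ = serve fuel x k (augment x s)

  initial : State
  initial _ = waiting 0 (s≤s z≤n)

  -- The most recent request comes first. Each augmentation raises the level of some set of any cover,
  -- so m * L of them suffice if there is one.
  play : Requests n → State
  play []      = initial
  play (x ∷ ρ) = serve (suc (m * L)) x (multiplicity (x ∷ ρ) x) (play ρ)

  serve-preserves : ∀ (P : State → Set) x k →
    (∀ s → ¬ (d * k ≤ d * covered x s + k) → P s → P (augment x s)) →
    ∀ fuel s → P s → P (serve fuel x k s)
  serve-preserves P x k step zero       s Ps = Ps
  serve-preserves P x k step (suc fuel) s Ps with d * k ≤? d * covered x s + k
  ... | yes _       = Ps
  ... | no  unserved = serve-preserves P x k step fuel (augment x s) (step s unserved Ps)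

  serve-chosen : ∀ fuel x k s i → isChosen (s i) ≡ true → isChosen (serve fuel x k s i) ≡ true
  serve-chosen fuel x k s i = serve-preserves (λ s → isChosen (s i) ≡ true) x k
    (λ s _ → augment-chosen (augment-step x s i)) fuel s

  covered-serve : ∀ fuel x k s y → covered y s ≤ covered y (serve fuel x k s)
  covered-serve fuel x k s y = sum-mono-≤ λ i →
    mono (contains S y i) (isChosen (s i)) _ (serve-chosen fuel x k s i)
    where
    mono : ∀ t b b′ → (b ≡ true → b′ ≡ true) → indicator (t ∧ b) ≤ indicator (t ∧ b′)
    mono false b     b′ imp = z≤n
    mono true  false b′ imp = z≤n
    mono true  true  b′ imp = ≤-reflexive (cong indicator (sym (imp refl)))

  -- Control of the potential.

  Bounded : State → Set
  Bounded s = potential s ≤ 2 ^ r * (8 * M) ^ m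

  serve-bounded : ∀ fuel x k s → Bounded s → Bounded (serve fuel x k s)
  serve-bounded fuel x k = serve-preserves Bounded x k
    (λ s _ → ≤-trans (proj₂ (proj₂ (augmentation x s)))) fuel

  estimator≤ : ∀ j s → Bounded s → estimator j s ≤ 2 ^ r * (8 * M) ^ m
  estimator≤ j s s-bounded = ≤-trans (≤-reflexive (sym (*-identityˡ (estimator j s))))
    (≤-trans (≤-sum (λ j → 1 * estimator j s) j) s-bounded)

  2m≤M : 2 * m ≤ M
  2m≤M = *-monoʳ-≤ 2 (n≤2^⌈log₂n⌉ m)

  -- After normalisation, index zero starts at most 1 and each of the n others at most (1 + 1/M)^m,
  -- which is at most 2 because 2m ≤ M.
  initial-bounded : Bounded initial
  initial-bounded = begin
    1 * estimator zero initial + sum (λ x → 1 * estimator (suc x) initial)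
      ≤⟨ +-mono-≤ overspend (sum-≤-const shortfall) ⟩
    (8 * M) ^ m + n * (2 * (8 * M) ^ m)
      ≡⟨ collect n ((8 * M) ^ m) ⟩
    (1 + 2 * n) * (8 * M) ^ m
      ≤⟨ *-monoˡ-≤ ((8 * M) ^ m) 1+2n≤2^r ⟩
    2 ^ r * (8 * M) ^ m ∎
    where
    open ≤-Reasoning
    collect : ∀ n b → b + n * (2 * b) ≡ (1 + 2 * n) * b
    collect = solve-∀
    reassoc : ∀ M → 4 * (2 * M) ≡ 8 * M
    reassoc = solve-∀
    swap : ∀ a b c → a * (b * c) ≡ b * (a * c)
    swap = solve-∀
    double : ∀ a → a + 2 * a + a ≡ 2 * (2 * a)
    double = solve-∀
    overspend-factor : ∀ i → factor zero i (initial i) ≤ 4 * (2 * M)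
    overspend-factor _ = *-monoʳ-≤ 4 (m∸n≤m (2 * M) 1)
    overspend : 1 * estimator zero initial ≤ (8 * M) ^ m
    overspend = begin
      1 * estimator zero initial          ≡⟨ *-identityˡ (estimator zero initial) ⟩
      estimator zero initial              ≤⟨ product-mono-≤ overspend-factor ⟩
      product {m} (λ _ → 4 * (2 * M))   ≡⟨ product-const m (4 * (2 * M)) ⟩
      (4 * (2 * M)) ^ m                 ≡⟨ cong (_^ m) (reassoc M) ⟩
      (8 * M) ^ m                       ∎
    shortfall-factor : ∀ x i → factor (suc x) i (initial i) ≤ 8 * suc M
    shortfall-factor x i with contains S x i
    ... | true  = *-monoʳ-≤ 8 (≤-reflexive (+-comm M 1))
    ... | false = *-monoʳ-≤ 8 (n≤1+n M)
    shortfall : ∀ x → 1 * estimator (suc x) initial ≤ 2 * (8 * M) ^ m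
    shortfall x = begin
      1 * estimator (suc x) initial       ≡⟨ *-identityˡ (estimator (suc x) initial) ⟩
      estimator (suc x) initial           ≤⟨ product-mono-≤ (shortfall-factor x) ⟩
      product {m} (λ _ → 8 * suc M)     ≡⟨ product-const m (8 * suc M) ⟩
      (8 * suc M) ^ m                   ≡⟨ ^-distribʳ-* 8 (suc M) m ⟩
      8 ^ m * suc M ^ m                 ≤⟨ *-monoʳ-≤ (8 ^ m) ([1+M]^t≤2*M^t M m 2m≤M) ⟩
      8 ^ m * (2 * M ^ m)               ≡⟨ swap (8 ^ m) 2 (M ^ m) ⟩
      2 * (8 ^ m * M ^ m)               ≡⟨ cong (2 *_) (^-distribʳ-* 8 M m) ⟨
      2 * (8 * M) ^ m                   ∎
    1+2n≤2^r : 1 + 2 * n ≤ 2 ^ r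
    1+2n≤2^r = begin
      1 + 2 * n                                               ≤⟨ +-mono-≤ (m^n>0 2 ⌈log₂ n ⌉) (*-monoʳ-≤ 2 (n≤2^⌈log₂n⌉ n)) ⟩
      2 ^ ⌈log₂ n ⌉ + 2 * 2 ^ ⌈log₂ n ⌉                       ≤⟨ m≤m+n _ (2 ^ ⌈log₂ n ⌉) ⟩
      2 ^ ⌈log₂ n ⌉ + 2 * 2 ^ ⌈log₂ n ⌉ + 2 ^ ⌈log₂ n ⌉       ≡⟨ double (2 ^ ⌈log₂ n ⌉) ⟩
      2 ^ r                                                   ∎

  -- Growth of the weights against progress of a cover.

  -- The product of 1 + w over all sets, scaled by `M ^ m`; chosen sets contribute their last
  -- weight.
  growth : State → ℕ
  growth s = product (λ i → M + 2 ^ level (s i))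

  progress : (Fin m → Bool) → State → ℕ
  progress F s = sum (λ i → indicator (F i) * level (s i))

  demand : (Fin m → Bool) → Fin n → ℕ
  demand F x = sum (λ i → indicator (F i ∧ contains S x i))

  progress≤ : ∀ F s → progress F s ≤ sum (indicator ∘ F) * L
  progress≤ F s = begin
    progress F s                        ≤⟨ sum-mono-≤ (λ i → ≤-trans (*-monoʳ-≤ (indicator (F i)) (level≤ (s i)))
                                             (≤-reflexive (*-comm (indicator (F i)) L))) ⟩
    sum (λ i → L * indicator (F i))     ≡⟨ *-distribˡ-sum L (indicator ∘ F) ⟨
    L * sum (indicator ∘ F)             ≡⟨ *-comm L (sum (indicator ∘ F)) ⟩
    sum (indicator ∘ F) * L             ∎
    where open ≤-Reasoning

  -- Of the sets of `F` containing x, at most `covered x s` are already chosen, and the others gain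
  -- a level. Adding on both sides avoids a truncated difference.
  progress-augment : ∀ F x s → progress F s + demand F x ≤ progress F (augment x s) + covered x s
  progress-augment F x s = begin
    progress F s + demand F x
      ≡⟨ ∑-distrib-+ (λ i → indicator (F i) * level (s i)) (λ i → indicator (F i ∧ contains S x i)) ⟨
    sum (λ i → indicator (F i) * level (s i) + indicator (F i ∧ contains S x i))
      ≤⟨ sum-mono-≤ (λ i → augment-level (augment-step x s i) (F i)) ⟩
    sum (λ i → indicator (F i) * level (augment x s i) + indicator (contains S x i ∧ isChosen (s i)))
      ≡⟨ ∑-distrib-+ (λ i → indicator (F i) * level (augment x s i)) _ ⟩
    progress F (augment x s) + covered x s ∎
    where open ≤-Reasoning

  -- For a waiting set containing x, 1 + 2w ≤ (1 + w)^2: one factor comes from `growth`, the other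
  -- from the estimator of x. A chosen set containing x contributes 1/2 to that estimator, which the
  -- power of 2 restores.
  growth-augment : ∀ x s → Bounded s → growth (augment x s) ≤ growth s * 2 ^ (r + covered x s)
  growth-augment x s s-bounded = *-cancelˡ-≤ ((8 * M) ^ m) {{m^n≢0 (8 * M) m {{m*n≢0 8 M}}}} (begin
    (8 * M) ^ m * growth s′
      ≡⟨ cong (_* growth s′) (product-const m (8 * M)) ⟨
    product {m} (λ _ → 8 * M) * growth s′
      ≡⟨ product-distrib-* (λ _ → 8 * M) (λ i → M + 2 ^ level (s′ i)) ⟨
    product (λ i → 8 * M * (M + 2 ^ level (s′ i)))
      ≤⟨ product-mono-≤ (λ i → pointwise i (augment-step x s i)) ⟩
    product (λ i → (M + 2 ^ level (s i)) * factor (suc x) i (s i) * 2 ^ c i)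
      ≡⟨ product-distrib-* (λ i → (M + 2 ^ level (s i)) * factor (suc x) i (s i)) (λ i → 2 ^ c i) ⟩
    product (λ i → (M + 2 ^ level (s i)) * factor (suc x) i (s i)) * product (λ i → 2 ^ c i)
      ≡⟨ cong₂ _*_ (product-distrib-* (λ i → M + 2 ^ level (s i)) (λ i → factor (suc x) i (s i))) (product-^ 2 c) ⟩
    growth s * estimator (suc x) s * 2 ^ covered x s
      ≤⟨ *-monoˡ-≤ (2 ^ covered x s) (*-monoʳ-≤ (growth s) (estimator≤ (suc x) s s-bounded)) ⟩
    growth s * (2 ^ r * (8 * M) ^ m) * 2 ^ covered x s
      ≡⟨ rearrange (growth s) (2 ^ r) ((8 * M) ^ m) (2 ^ covered x s) ⟩
    (8 * M) ^ m * (growth s * (2 ^ r * 2 ^ covered x s))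
      ≡⟨ cong (λ k → (8 * M) ^ m * (growth s * k)) (^-distribˡ-+-* 2 r (covered x s)) ⟨
    (8 * M) ^ m * (growth s * 2 ^ (r + covered x s)) ∎)
    where
    open ≤-Reasoning
    s′ = augment x s
    c : Fin m → ℕ
    c i = indicator (contains S x i ∧ isChosen (s i))
    rearrange : ∀ a b c d → a * (b * c) * d ≡ c * (a * (b * d))
    rearrange = solve-∀
    trivial : ∀ M y → 8 * M * y ≡ y * (8 * M) * 1
    trivial = solve-∀
    halved : ∀ M y → 8 * M * y ≡ y * (4 * M) * 2
    halved = solve-∀
    square : ∀ M x → 8 * M * (M + 2 * x) + 8 * (x * x) ≡ (M + x) * (8 * (M + x)) * 1
    square = solve-∀
    doubling : ∀ M x → 8 * M * (M + 2 * x) ≤ (M + x) * (8 * (M + x)) * 1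
    doubling M x = m+n≤o⇒m≤o _ (≤-reflexive (square M x))
    pointwise : ∀ i {a a′} → Augment (contains S x i) a a′ →
      8 * M * (M + 2 ^ level a′) ≤
        (M + 2 ^ level a) * factor (suc x) i a * 2 ^ indicator (contains S x i ∧ isChosen a)
    pointwise i {waiting e _} step with contains S x i | step
    ... | false | outside = ≤-reflexive (trivial M (M + 2 ^ e))
    ... | true  | raised  = doubling M (2 ^ e)
    ... | true  | bought  = doubling M (2 ^ e)
    pointwise i {chosen e _} step with contains S x i | step
    ... | false | outside = ≤-reflexive (trivial M (M + 2 ^ e))
    ... | true  | settled = ≤-reflexive (halved M (M + 2 ^ e))

  -- An augmentation multiplies growth by 2 ^ (r + c) and is made only if c < (1 - 1/d) k; it then
  -- raises the progress of every cover by at least k - c ≥ (r + c) / (d + r).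
  Charged : (Fin m → Bool) → State → Set
  Charged F s = growth s ≤ 2 ^ suc ((d + r) * progress F s) * M ^ m

  serve-charged : ∀ F fuel x k s → k ≤ demand F x → Bounded s → Charged F s → Charged F (serve fuel x k s)
  serve-charged F fuel x k s k≤ s-bounded s-charged =
    proj₂ (serve-preserves (λ s → Bounded s × Charged F s) x k step fuel s (s-bounded , s-charged))
    where
    -- With suc u = k - c, the failed test reads k < d (k - c). Hence c < k < d (k - c), while r ≤ r
    -- (k - c) because k - c ≥ 1.
    charge : ∀ c θ θ′ → ¬ (d * k ≤ d * c + k) → θ + k ≤ θ′ + c → (d + r) * θ + (r + c) ≤ (d + r) * θ′
    charge c θ θ′ unserved θ+k≤θ′+c = begin
      (d + r) * θ + (r + c)             ≤⟨ +-monoʳ-≤ ((d + r) * θ) (+-mono-≤ (m≤m*n r (suc u)) c≤d*u) ⟩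
      (d + r) * θ + (r * suc u + d * suc u)   ≡⟨ collect d r θ (suc u) ⟩
      (d + r) * (θ + suc u)             ≤⟨ *-monoʳ-≤ (d + r) θ+u≤θ′ ⟩
      (d + r) * θ′                      ∎
      where
      open ≤-Reasoning
      dc+k<dk : d * c + k < d * k
      dc+k<dk = ≰⇒> unserved
      c<k : c < k
      c<k = *-cancelˡ-< d c k (≤-<-trans (m≤m+n (d * c) k) dc+k<dk)
      u = k ∸ suc c
      k≡ : suc u + c ≡ k
      k≡ = trans (sym (+-suc u c)) (m∸n+n≡m c<k)
      k<d*u : k < d * suc u
      k<d*u = +-cancelˡ-< (d * c) k (d * suc u) (<-≤-trans dc+k<dk (≤-reflexive
        (trans (cong (d *_) (trans (sym k≡) (+-comm (suc u) c))) (*-distribˡ-+ d c (suc u)))))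
      c≤d*u : c ≤ d * suc u
      c≤d*u = <⇒≤ (<-trans c<k k<d*u)
      θ+u≤θ′ : θ + suc u ≤ θ′
      θ+u≤θ′ = +-cancelʳ-≤ c (θ + suc u) θ′ (≤-trans (≤-reflexive
        (trans (+-assoc θ (suc u) c) (cong (λ k → θ + k) k≡))) θ+k≤θ′+c)
      collect : ∀ d r θ u → (d + r) * θ + (r * u + d * u) ≡ (d + r) * (θ + u)
      collect = solve-∀
    step : ∀ s → ¬ (d * k ≤ d * covered x s + k) → Bounded s × Charged F s →
      Bounded (augment x s) × Charged F (augment x s)
    step s unserved (s-bounded , s-charged) =
      ≤-trans (proj₂ (proj₂ (augmentation x s))) s-bounded , (begin
        growth (augment x s)
          ≤⟨ growth-augment x s s-bounded ⟩
        growth s * 2 ^ (r + covered x s)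
          ≤⟨ *-monoˡ-≤ (2 ^ (r + covered x s)) s-charged ⟩
        2 ^ suc ((d + r) * progress F s) * M ^ m * 2 ^ (r + covered x s)
          ≡⟨ swap (2 ^ suc ((d + r) * progress F s)) (M ^ m) (2 ^ (r + covered x s)) ⟩
        2 ^ suc ((d + r) * progress F s) * 2 ^ (r + covered x s) * M ^ m
          ≡⟨ cong (_* M ^ m) (^-distribˡ-+-* 2 (suc ((d + r) * progress F s)) (r + covered x s)) ⟨
        2 ^ suc ((d + r) * progress F s + (r + covered x s)) * M ^ m
          ≤⟨ *-monoˡ-≤ (M ^ m) (^-monoʳ-≤ 2 (s≤s (charge (covered x s) (progress F s) (progress F (augment x s)) unserved
               (≤-trans (+-monoʳ-≤ (progress F s) k≤) (progress-augment F x s))))) ⟩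
        2 ^ suc ((d + r) * progress F (augment x s)) * M ^ m ∎)
      where
      open ≤-Reasoning
      swap : ∀ x y z → x * y * z ≡ x * z * y
      swap = solve-∀

  -- The `suc` in the exponent of `Charged` pays for (1 + 1/M)^m ≤ 2.
  initial-charged : ∀ F → Charged F initial
  initial-charged F = begin
    growth initial                                     ≡⟨ product-const m (M + 1) ⟩
    (M + 1) ^ m                                      ≡⟨ cong (_^ m) (+-comm M 1) ⟩
    suc M ^ m                                        ≤⟨ [1+M]^t≤2*M^t M m 2m≤M ⟩
    2 * M ^ m                                        ≤⟨ *-monoˡ-≤ (M ^ m) (^-monoʳ-≤ 2 (s≤s (z≤n {(d + r) * progress F initial}))) ⟩
    2 ^ suc ((d + r) * progress F initial) * M ^ m     ∎
    where open ≤-Reasoning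

  -- The number of purchases.

  spending : State → ℕ
  spending s = sum (λ i → indicator (isChosen (s i)))

  -- As (1 - w/2) (1 + w) ≥ 1 for each set, the normalised product of estimator zero and growth is
  -- at least (5/4)^spending. `Bounded` and `Charged` cap it by a power of 2; taking logarithms
  -- costs the factor 4.
  spending≤ : ∀ F s → Bounded s → Charged F s →
    spending s ≤ 4 * (r + suc ((d + r) * progress F s))
  spending≤ F s s-bounded s-charged = 5^c≤4^c*2^b⇒c≤4*b (r + b) (spending s)
    (*-cancelˡ-≤ (M ^ m * (8 * M) ^ m)
      {{m*n≢0 (M ^ m) ((8 * M) ^ m) {{m^n≢0 M m}} {{m^n≢0 (8 * M) m {{m*n≢0 8 M}}}}}} (begin
    M ^ m * (8 * M) ^ m * 5 ^ spending s
      ≡⟨ cong₂ _*_ (^-distribʳ-* M (8 * M) m) (product-^ 5 c) ⟨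
    (M * (8 * M)) ^ m * product (λ i → 5 ^ c i)
      ≡⟨ cong (_* product (λ i → 5 ^ c i)) (product-const m (M * (8 * M))) ⟨
    product {m} (λ _ → M * (8 * M)) * product (λ i → 5 ^ c i)
      ≡⟨ product-distrib-* (λ _ → M * (8 * M)) (λ i → 5 ^ c i) ⟨
    product (λ i → M * (8 * M) * 5 ^ c i)
      ≤⟨ product-mono-≤ (λ i → pointwise i (s i)) ⟩
    product (λ i → 4 ^ c i * (factor zero i (s i) * (M + 2 ^ level (s i))))
      ≡⟨ product-distrib-* (λ i → 4 ^ c i) (λ i → factor zero i (s i) * (M + 2 ^ level (s i))) ⟩
    product (λ i → 4 ^ c i) * product (λ i → factor zero i (s i) * (M + 2 ^ level (s i)))
      ≡⟨ cong₂ _*_ (product-^ 4 c) (product-distrib-* (λ i → factor zero i (s i)) (λ i → M + 2 ^ level (s i))) ⟩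
    4 ^ spending s * (estimator zero s * growth s)
      ≤⟨ *-monoʳ-≤ (4 ^ spending s) (*-mono-≤ (estimator≤ zero s s-bounded) s-charged) ⟩
    4 ^ spending s * (2 ^ r * (8 * M) ^ m * (2 ^ b * M ^ m))
      ≡⟨ rearrange (4 ^ spending s) (2 ^ r) ((8 * M) ^ m) (2 ^ b) (M ^ m) ⟩
    M ^ m * (8 * M) ^ m * (4 ^ spending s * (2 ^ r * 2 ^ b))
      ≡⟨ cong (λ k → M ^ m * (8 * M) ^ m * (4 ^ spending s * k)) (^-distribˡ-+-* 2 r b) ⟨
    M ^ m * (8 * M) ^ m * (4 ^ spending s * 2 ^ (r + b)) ∎))
    where
    open ≤-Reasoning
    b = suc ((d + r) * progress F s)
    c : Fin m → ℕ
    c i = indicator (isChosen (s i))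
    rearrange : ∀ p q u v w → p * (q * u * (v * w)) ≡ w * u * (p * (q * v))
    rearrange = solve-∀
    scale : ∀ y z → 4 * y * z * 5 ≡ 4 * (5 * y * z)
    scale = solve-∀
    pointwise : ∀ i a → M * (8 * M) * 5 ^ indicator (isChosen a) ≤
      4 ^ indicator (isChosen a) * (factor zero i a * (M + 2 ^ level a))
    pointwise i (waiting e e<L) = begin
      M * (8 * M) * 1                              ≡⟨ *-identityʳ (M * (8 * M)) ⟩
      M * (8 * M)                                  ≤⟨ overspend-bound (2 ^ e) (M ∸ 2 ^ e) (m∸n+n≡m (^-monoʳ-≤ 2 (<⇒≤ e<L))) ⟩
      4 * (2 * M ∸ 2 ^ e) * (M + 2 ^ e)            ≡⟨ *-identityˡ (4 * (2 * M ∸ 2 ^ e) * (M + 2 ^ e)) ⟨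
      1 * (4 * (2 * M ∸ 2 ^ e) * (M + 2 ^ e))      ∎
    pointwise i (chosen e e≤L) = begin
      M * (8 * M) * 5                              ≤⟨ *-monoˡ-≤ 5 (overspend-bound (2 ^ e) (M ∸ 2 ^ e) (m∸n+n≡m (^-monoʳ-≤ 2 e≤L))) ⟩
      4 * (2 * M ∸ 2 ^ e) * (M + 2 ^ e) * 5        ≡⟨ scale (2 * M ∸ 2 ^ e) (M + 2 ^ e) ⟩
      4 * (5 * (2 * M ∸ 2 ^ e) * (M + 2 ^ e))      ∎

  -- Service of the requests.

  -- A failed test forces the coverage below k, hence below the demand, so every augmentation raises
  -- the progress of `F` by at least 1.
  serve-serves : ∀ F fuel x k s → k ≤ demand F x →
    let s′ = serve fuel x k s in
    d * k ≤ d * covered x s′ + k ⊎ fuel + progress F s ≤ progress F s′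
  serve-serves F zero       x k s k≤ = inj₂ ≤-refl
  serve-serves F (suc fuel) x k s k≤ with d * k ≤? d * covered x s + k
  ... | yes served   = inj₁ served
  ... | no  unserved with serve-serves F fuel x k (augment x s) k≤
  ...   | inj₁ served = inj₁ served
  ...   | inj₂ progressed = inj₂ (≤-trans (≤-reflexive (sym (+-suc fuel (progress F s))))
      (≤-trans (+-monoʳ-≤ fuel progress<) progressed))
    where
    covered<k : covered x s < k
    covered<k = *-cancelˡ-< d (covered x s) k (≤-<-trans (m≤m+n (d * covered x s) k) (≰⇒> unserved))
    progress< : progress F s < progress F (augment x s)
    progress< = +-cancelʳ-< k (progress F s) (progress F (augment x s)) (≤-<-trans
      (≤-trans (+-monoʳ-≤ (progress F s) k≤) (progress-augment F x s))
      (+-monoʳ-< (progress F (augment x s)) covered<k))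

  cover⇒demand : ∀ ρ F → IsCover S ρ F → ∀ x → multiplicity ρ x ≤ demand (lookup F) x
  cover⇒demand ρ F cover x = ≤-trans (cover x) (≤-reflexive (coverCount≡sum S F x))

  multiplicity-∷ : ∀ x (ρ : Requests n) y → multiplicity ρ y ≤ multiplicity (x ∷ ρ) y
  multiplicity-∷ x ρ y with x ≟ y
  ... | yes _ = n≤1+n _
  ... | no  _ = ≤-refl

  -- This lets one cover of the whole sequence be compared with the algorithm at all earlier times.
  cover-tail : ∀ x ρ F → IsCover S (x ∷ ρ) F → IsCover S ρ F
  cover-tail x ρ F cover y = ≤-trans (multiplicity-∷ x ρ y) (cover y)

  play-bounded : ∀ ρ → Bounded (play ρ)
  play-bounded []      = initial-bounded
  play-bounded (x ∷ ρ) = serve-bounded (suc (m * L)) x (multiplicity (x ∷ ρ) x) (play ρ) (play-bounded ρ)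

  play-charged : ∀ ρ F → IsCover S ρ F → Charged (lookup F) (play ρ)
  play-charged []      F cover = initial-charged (lookup F)
  play-charged (x ∷ ρ) F cover = serve-charged (lookup F) (suc (m * L)) x (multiplicity (x ∷ ρ) x) (play ρ)
    (cover⇒demand (x ∷ ρ) F cover x) (play-bounded ρ) (play-charged ρ F (cover-tail x ρ F cover))

  multiplicity-other : ∀ {x y} (ρ : Requests n) → x ≢ y → multiplicity (x ∷ ρ) y ≡ multiplicity ρ y
  multiplicity-other {x} {y} ρ x≢y with x ≟ y
  ... | yes x≡y = contradiction x≡y x≢y
  ... | no  _   = refl

  -- The progress of `F` is at most `m * L`, so fuel `suc (m * L)` cannot run out. For elements
  -- other than the newest, the multiplicity is unchanged and coverage only grows.
  play-serves : ∀ ρ F → IsCover S ρ F → ∀ y →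
    d * multiplicity ρ y ≤ d * covered y (play ρ) + multiplicity ρ y
  play-serves []      F cover y = ≤-trans (≤-reflexive (*-zeroʳ d)) z≤n
  play-serves (x ∷ ρ) F cover y with serve-serves (lookup F) (suc (m * L)) x (multiplicity (x ∷ ρ) x) (play ρ)
                                       (cover⇒demand (x ∷ ρ) F cover x)
  ... | inj₂ progressed = contradiction (≤-trans (m≤m+n _ (progress (lookup F) (play ρ))) progressed) (≤⇒≯ (begin
    progress (lookup F) (play (x ∷ ρ))    ≤⟨ progress≤ (lookup F) (play (x ∷ ρ)) ⟩
    sum (indicator ∘ lookup F) * L        ≡⟨ cong (_* L) (∣p∣≡sum F) ⟨
    ∣ F ∣ * L                             ≤⟨ *-monoˡ-≤ L (∣p∣≤n F) ⟩
    m * L                                 ∎))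
    where open ≤-Reasoning
  ... | inj₁ served = by-cases (x ≟ y)
    where
    by-cases : Dec (x ≡ y) → d * multiplicity (x ∷ ρ) y ≤ d * covered y (play (x ∷ ρ)) + multiplicity (x ∷ ρ) y
    by-cases (yes refl) = served
    by-cases (no x≢y)   = subst (λ k → d * k ≤ d * covered y (play (x ∷ ρ)) + k) (sym (multiplicity-other ρ x≢y))
      (≤-trans (play-serves ρ F (cover-tail x ρ F cover) y)
        (+-monoˡ-≤ (multiplicity ρ y) (*-monoʳ-≤ d (covered-serve (suc (m * L)) x _ (play ρ) y))))

  -- The online algorithm and its cost.

  purchases : Requests n → Subset m
  purchases σ = tabulate (isChosen ∘ play (reverse σ))

  lookup-purchases : ∀ σ i → lookup (purchases σ) i ≡ isChosen (play (reverse σ) i)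
  lookup-purchases σ = lookup∘tabulate (isChosen ∘ play (reverse σ))

  cover-reverse : ∀ σ F → IsCover S σ F → IsCover S (reverse σ) F
  cover-reverse σ F cover x = ≤-trans (≤-reflexive (multiplicity-reverse σ x)) (cover x)

  -- Reversal turns the appended request into the head, so it amounts to one more `serve`, which
  -- keeps chosen sets chosen.
  purchases-irrevocable : Irrevocable purchases
  purchases-irrevocable σ x {i} i∈ = lookup⇒[]= i (purchases (σ ∷ʳ x)) (begin
    lookup (purchases (σ ∷ʳ x)) i               ≡⟨ lookup-purchases (σ ∷ʳ x) i ⟩
    isChosen (play (reverse (σ ∷ʳ x)) i)        ≡⟨ cong (λ ρ → isChosen (play ρ i)) (reverse-++ σ (x ∷ [])) ⟩
    isChosen (play (x ∷ reverse σ) i)           ≡⟨ serve-chosen (suc (m * L)) x _ (play (reverse σ)) i bought-before ⟩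
    true                                        ∎)
    where
    open ≡-Reasoning
    bought-before : isChosen (play (reverse σ) i) ≡ true
    bought-before = trans (sym (lookup-purchases σ i)) ([]=⇒lookup i∈)

  purchases-cover : ∀ σ F → IsCover S σ F → ∀ x →
    d * multiplicity σ x ≤ d * coverCount S (purchases σ) x + multiplicity σ x
  purchases-cover σ F cover x = subst₂ (λ k c → d * k ≤ d * c + k) (multiplicity-reverse σ x) (sym covered≡)
    (play-serves (reverse σ) F (cover-reverse σ F cover) x)
    where
    covered≡ : coverCount S (purchases σ) x ≡ covered x (play (reverse σ))
    covered≡ = trans (coverCount≡sum S (purchases σ) x) (sum-cong-≗ λ i → cong indicator
      (trans (cong (_∧ contains S x i) (lookup-purchases σ i))
        (∧-comm (isChosen (play (reverse σ) i)) (contains S x i))))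

  ∣purchases∣≡spending : ∀ σ → ∣ purchases σ ∣ ≡ spending (play (reverse σ))
  ∣purchases∣≡spending σ = trans (∣p∣≡sum (purchases σ)) (sum-cong-≗
    {x = indicator ∘ lookup (purchases σ)} (λ i → cong indicator (lookup-purchases σ i)))

  requests⇒nonempty : ∀ x σ F → IsCover S (x ∷ σ) F → 0 < ∣ F ∣
  requests⇒nonempty x σ F cover =
    <-≤-trans requested (≤-trans (cover x) (∣p∩q∣≤∣p∣ F (setsContaining S x)))
    where
    requested : 0 < multiplicity (x ∷ σ) x
    requested with x ≟ x
    ... | yes _   = s≤s z≤n
    ... | no  x≢x = contradiction refl x≢x

  -- The empty request sequence is separated because of the additive term in spending≤.
  purchases-cost : ∀ σ F → IsCover S σ F → ∣ purchases σ ∣ ≤ 4 * (d + 5) * logFactor n m * ∣ F ∣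
  purchases-cost []        F cover =
    ≤-trans (≤-reflexive (trans (∣purchases∣≡spending []) (sum-replicate-zero m))) z≤n
  purchases-cost σ@(x ∷ τ) F cover = begin
    ∣ purchases σ ∣                                 ≡⟨ ∣purchases∣≡spending σ ⟩
    spending (play ρ)                               ≤⟨ spending≤ (lookup F) (play ρ) (play-bounded ρ)
                                                         (play-charged ρ F (cover-reverse σ F cover)) ⟩
    4 * (r + suc ((d + r) * progress (lookup F) (play ρ)))
                                                    ≤⟨ *-monoʳ-≤ 4 (+-monoʳ-≤ r (s≤s (*-monoʳ-≤ (d + r) progress≤∣F∣L))) ⟩
    4 * (r + suc ((d + r) * (∣ F ∣ * L)))           ≤⟨ *-monoʳ-≤ 4 total ⟩
    4 * ((d + 5) * (L * Λ * ∣ F ∣))                 ≡⟨ assoc (d + 5) (L * Λ) ∣ F ∣ ⟩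
    4 * (d + 5) * logFactor n m * ∣ F ∣             ∎
    where
    open ≤-Reasoning
    ρ = reverse σ
    ℓ = ⌈log₂ n ⌉
    Λ = suc ℓ
    assoc : ∀ a b c → 4 * (a * (b * c)) ≡ 4 * a * b * c
    assoc = solve-∀
    progress≤∣F∣L : progress (lookup F) (play ρ) ≤ ∣ F ∣ * L
    progress≤∣F∣L = ≤-trans (progress≤ (lookup F) (play ρ)) (≤-reflexive (cong (_* L) (sym (∣p∣≡sum F))))
    -- A nonempty cover absorbs the additive term r + 1 ≤ 3 Λ. This 3 and the d + 2 of `d+r≤` make
    -- up d + 5.
    Λ≤ : Λ ≤ ∣ F ∣ * L * Λ
    Λ≤ = m≤n*m Λ (∣ F ∣ * L) {{m*n≢0 ∣ F ∣ L {{>-nonZero (requests⇒nonempty x τ F cover)}}}}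
    d+r≤ : d + r ≤ (d + 2) * Λ
    d+r≤ = m+n≤o⇒m≤o _ (≤-reflexive (slack d ℓ))
      where
      slack : ∀ d ℓ → d + (2 + ℓ) + (d * ℓ + ℓ) ≡ (d + 2) * suc ℓ
      slack = solve-∀
    r+1≤ : r + 1 ≤ 3 * Λ
    r+1≤ = m+n≤o⇒m≤o _ (≤-reflexive (slack ℓ))
      where
      slack : ∀ ℓ → 2 + ℓ + 1 + 2 * ℓ ≡ 3 * suc ℓ
      slack = solve-∀
    total : r + suc ((d + r) * (∣ F ∣ * L)) ≤ (d + 5) * (L * Λ * ∣ F ∣)
    total = begin
      r + suc ((d + r) * (∣ F ∣ * L))                          ≡⟨ shift r ((d + r) * (∣ F ∣ * L)) ⟩
      r + 1 + (d + r) * (∣ F ∣ * L)                            ≤⟨ +-mono-≤ (≤-trans r+1≤ (*-monoʳ-≤ 3 Λ≤)) (*-monoˡ-≤ (∣ F ∣ * L) d+r≤) ⟩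
      3 * (∣ F ∣ * L * Λ) + (d + 2) * Λ * (∣ F ∣ * L)          ≡⟨ collect d ∣ F ∣ L Λ ⟩
      (d + 5) * (L * Λ * ∣ F ∣)                                ∎
      where
      shift : ∀ a b → a + suc b ≡ a + 1 + b
      shift = solve-∀
      collect : ∀ d f l k → 3 * (f * l * k) + (d + 2) * k * (f * l) ≡ (d + 5) * (l * k * f)
      collect = solve-∀

theorem4 : (ε : ℚ) → 0ℚ <ℚ ε →
    ∃ λ (C : ℕ) →
    (n m : ℕ) (S : Family n m) →
    Σ (OnlineAlg n m) λ A →
    Irrevocable A ×
    ((σ : Requests n) → ∃ (IsCover S σ) →
    ((x : _) → ((1ℚ - ε) *ℚ ((+ multiplicity σ x) / 1)) ≤ℚ ((+ coverCount S (A σ) x) / 1))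
    × ((F : Subset m) → IsCover S σ F → ∣ A σ ∣ ≤ C * logFactor n m * ∣ F ∣))
theorem4 ε 0<ε = 4 * (d + 5) , λ n m S → let open Algorithm S d in
  purchases , purchases-irrevocable , λ σ (F , cover) →
    (λ x → fractional-coverage ε 0<ε (multiplicity σ x) _ (purchases-cover σ F cover x)) ,
    purchases-cost σ
  where
  -- Coverage (1 - 1/d) k is enough, as 1/d ≤ `ε`.
  d = ↧ₙ ε
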